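{- Let $G$ be a finite simple graph and let $H$ be a spanning subgraph of $G$ (that is, $V(H)=V(G)$ and $E(H)\subseteq E(G)$). Then for any $B\subseteq V(G)$, $$\zeta_G(B)\le \zeta_H(B).$$
   Context: For a finite simple graph $G$ and a subset $B\subseteq V(G)$, the $B$-restricted clique polynomial is $C_B(G;x)=\sum_{i=0}^{\omega(G[B])} c_i(B)x^i$, where $c_i(B)$ is the number of subsets $K\subseteq B$ with $|K|=i$ that are cliques in $G$; the empty set counts as a clique, so $c_0(B)=1$. Let $Z_B(G)=\{x<0 : C_B(G;x)=0\}$ (real $x$). If $Z_B(G)\neq\emptyset$, define $\zeta_G(B)=\max Z_B(G)$, the largest negative root of $C_B(G;x)$; if $Z_B(G)=\emptyset$, set $\zeta_G(B)=-\infty$. -}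

module Defs where

open import Algebra.Bundles.Raw using (RawSemiring)
import Algebra.Definitions.RawSemiring as RawSemiringDefinitions
open import Data.Fin.Base using (Fin; toℕ)
open import Data.Fin.Properties using (all?) renaming (_≟_ to _≟ᶠ_)
open import Data.Fin.Subset using (Subset; inside; outside; _∈_; _⊆_; ∣_∣)
open import Data.Fin.Subset.Properties using (_∈?_; _⊆?_)
open import Data.List.Base using (List; []; _∷_; _++_; map; filter; length)
open import Data.List.Extrema.Nat using (max)
open import Data.Nat.Base as ℕ using (ℕ; zero; suc)
import Data.Nat.Properties as ℕ
open import Data.Product.Base using (∃-syntax; _×_; _,_)
open import Data.Rational.Base as ℚ using (ℚ; 0ℚ; 1ℚ; ½)
import Data.Rational.Properties as ℚ
open import Data.Rational.Solver using (module +-*-Solver)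
open import Data.Vec.Base using ([]; _∷_)
open import Level using (0ℓ)
open import Relation.Binary.Core using (Rel)
open import Relation.Binary.Definitions using (Decidable; Symmetric; Irreflexive)
open import Relation.Binary.PropositionalEquality using (_≡_; _≢_; refl; sym; trans; cong; cong₂; subst)
open import Relation.Nullary.Construct.Add.Infimum using (_₋; ⊥₋; [_])
open import Relation.Nullary.Decidable using (_×-dec_; _→-dec_; ¬?)
open import Relation.Unary using (Pred; Empty)
import Relation.Unary as U

-- The reals are Cauchy sequences of rationals with _≈_ below as equality; no
-- quotient is taken, and the ring operations act termwise.

IsCauchy : (ℕ → ℚ) → Set
IsCauchy s = ∀ ε → 0ℚ ℚ.< ε →
  ∃[ N ] (∀ m n → N ℕ.≤ m → N ℕ.≤ n → ℚ.∣ s m ℚ.- s n ∣ ℚ.< ε)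

record ℝ : Set where
  constructor mkℝ
  field
    seq    : ℕ → ℚ
    cauchy : IsCauchy seq

open ℝ public

infix 4 _≈_ _≤_ _<_

_≈_ : Rel ℝ 0ℓ
x ≈ y = ∀ ε → 0ℚ ℚ.< ε →
  ∃[ N ] (∀ n → N ℕ.≤ n → ℚ.∣ seq x n ℚ.- seq y n ∣ ℚ.< ε)

_≤_ : Rel ℝ 0ℓ
x ≤ y = ∀ ε → 0ℚ ℚ.< ε →
  ∃[ N ] (∀ n → N ℕ.≤ n → seq x n ℚ.< seq y n ℚ.+ ε)

_<_ : Rel ℝ 0ℓ
x < y = ∃[ ε ] (0ℚ ℚ.< ε ×
  ∃[ N ] (∀ n → N ℕ.≤ n → seq x n ℚ.+ ε ℚ.< seq y n))

private
  constCauchy : ∀ q → IsCauchy (λ _ → q)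
  constCauchy q ε ε>0 = 0 , λ _ _ _ _ →
    subst (ℚ._< ε) (sym (cong ℚ.∣_∣ (ℚ.+-inverseʳ q))) ε>0

  half>0 : ∀ {ε} → 0ℚ ℚ.< ε → 0ℚ ℚ.< ½ ℚ.* ε
  half>0 {ε} ε>0 =
    subst (ℚ._< ½ ℚ.* ε) (ℚ.*-zeroʳ ½) (ℚ.*-monoʳ-<-pos ½ ε>0)

  halves : ∀ ε → ½ ℚ.* ε ℚ.+ ½ ℚ.* ε ≡ ε
  halves ε = trans (sym (ℚ.*-distribʳ-+ ε ½ ½)) (ℚ.*-identityˡ ε)

  +-cauchy : ∀ s t → IsCauchy s → IsCauchy t → IsCauchy (λ n → s n ℚ.+ t n)
  +-cauchy s t cs ct ε ε>0 with cs (½ ℚ.* ε) (half>0 ε>0) | ct (½ ℚ.* ε) (half>0 ε>0)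
  ... | N₁ , h₁ | N₂ , h₂ = N₁ ℕ.⊔ N₂ , λ m n Nm Nn → begin-strict
      ℚ.∣ (s m ℚ.+ t m) ℚ.- (s n ℚ.+ t n) ∣
        ≡⟨ cong ℚ.∣_∣ (regroup (s m) (t m) (s n) (t n)) ⟩
      ℚ.∣ (s m ℚ.- s n) ℚ.+ (t m ℚ.- t n) ∣
        ≤⟨ ℚ.∣p+q∣≤∣p∣+∣q∣ (s m ℚ.- s n) (t m ℚ.- t n) ⟩
      ℚ.∣ s m ℚ.- s n ∣ ℚ.+ ℚ.∣ t m ℚ.- t n ∣
        <⟨ ℚ.+-mono-< (h₁ m n (ℕ.m⊔n≤o⇒m≤o N₁ N₂ Nm) (ℕ.m⊔n≤o⇒m≤o N₁ N₂ Nn))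
                      (h₂ m n (ℕ.m⊔n≤o⇒n≤o N₁ N₂ Nm) (ℕ.m⊔n≤o⇒n≤o N₁ N₂ Nn)) ⟩
      ½ ℚ.* ε ℚ.+ ½ ℚ.* ε
        ≡⟨ halves ε ⟩
      ε ∎
    where
    open ℚ.≤-Reasoning
    regroup : ∀ a b c d → (a ℚ.+ b) ℚ.- (c ℚ.+ d) ≡ (a ℚ.- c) ℚ.+ (b ℚ.- d)
    regroup = solve 4 (λ a b c d → (a :+ b) :- (c :+ d) := (a :- c) :+ (b :- d)) refl
      where open +-*-Solver

  eventuallyBounded : ∀ s → IsCauchy s →
    ∃[ M ] (0ℚ ℚ.< M × ∃[ N ] (∀ n → N ℕ.≤ n → ℚ.∣ s n ∣ ℚ.≤ M))
  eventuallyBounded s cs with cs 1ℚ (ℚ.positive⁻¹ 1ℚ)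
  ... | N , h = ℚ.∣ s N ∣ ℚ.+ 1ℚ
              , subst (ℚ._< ℚ.∣ s N ∣ ℚ.+ 1ℚ) (ℚ.+-identityˡ 0ℚ)
                  (ℚ.+-mono-≤-< (ℚ.0≤∣p∣ (s N)) (ℚ.positive⁻¹ 1ℚ))
              , N
              , λ n Nn → begin
      ℚ.∣ s n ∣
        ≡⟨ cong ℚ.∣_∣ (regroup (s n) (s N)) ⟩
      ℚ.∣ s N ℚ.+ (s n ℚ.- s N) ∣
        ≤⟨ ℚ.∣p+q∣≤∣p∣+∣q∣ (s N) (s n ℚ.- s N) ⟩
      ℚ.∣ s N ∣ ℚ.+ ℚ.∣ s n ℚ.- s N ∣
        ≤⟨ ℚ.+-monoʳ-≤ ℚ.∣ s N ∣ (ℚ.<⇒≤ (h n N Nn ℕ.≤-refl)) ⟩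
      ℚ.∣ s N ∣ ℚ.+ 1ℚ ∎
    where
    open ℚ.≤-Reasoning
    regroup : ∀ a b → a ≡ b ℚ.+ (a ℚ.- b)
    regroup = solve 2 (λ a b → a := b :+ (a :- b)) refl
      where open +-*-Solver

  scaled : ∀ {M} → 0ℚ ℚ.< M → ∀ {ε} → 0ℚ ℚ.< ε →
    ∃[ δ ] (0ℚ ℚ.< δ × M ℚ.* δ ≡ ε)
  scaled {M} M>0 {ε} ε>0 = 1/M ℚ.* ε
    , subst (ℚ._< 1/M ℚ.* ε) (ℚ.*-zeroʳ 1/M) (ℚ.*-monoʳ-<-pos 1/M ε>0)
    , trans (sym (ℚ.*-assoc M 1/M ε))
        (trans (cong (ℚ._* ε) (ℚ.*-inverseʳ M)) (ℚ.*-identityˡ ε))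
    where
    instance
      M-pos = ℚ.positive M>0
      M-nonZero = ℚ.pos⇒nonZero M
    1/M = ℚ.1/ M
    instance
      1/M-pos = ℚ.1/pos⇒pos M

  *-regroup : ∀ a b c d → a ℚ.* b ℚ.- c ℚ.* d ≡ a ℚ.* (b ℚ.- d) ℚ.+ d ℚ.* (a ℚ.- c)
  *-regroup = solve 4 (λ a b c d → a :* b :- c :* d := a :* (b :- d) :+ d :* (a :- c)) refl
    where open +-*-Solver

  *-step : ∀ a M d δ → 0ℚ ℚ.< M → ℚ.∣ a ∣ ℚ.≤ M → ℚ.∣ d ∣ ℚ.< δ →
           ℚ.∣ a ∣ ℚ.* ℚ.∣ d ∣ ℚ.< M ℚ.* δ
  *-step a M d δ M>0 a≤M d<δ = ℚ.≤-<-trans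
    (ℚ.*-monoʳ-≤-nonNeg ℚ.∣ d ∣ {{ℚ.∣-∣-nonNeg d}} a≤M)
    (ℚ.*-monoʳ-<-pos M {{ℚ.positive M>0}} d<δ)

  *-bound : ∀ a b c d M₁ M₂ δ₁ δ₂ → 0ℚ ℚ.< M₁ → 0ℚ ℚ.< M₂ →
    ℚ.∣ a ∣ ℚ.≤ M₁ → ℚ.∣ d ∣ ℚ.≤ M₂ → ℚ.∣ b ℚ.- d ∣ ℚ.< δ₁ → ℚ.∣ a ℚ.- c ∣ ℚ.< δ₂ →
    ℚ.∣ a ℚ.* b ℚ.- c ℚ.* d ∣ ℚ.< M₁ ℚ.* δ₁ ℚ.+ M₂ ℚ.* δ₂
  *-bound a b c d M₁ M₂ δ₁ δ₂ M₁>0 M₂>0 a≤ d≤ bd< ac< = begin-strict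
    ℚ.∣ a ℚ.* b ℚ.- c ℚ.* d ∣
      ≡⟨ cong ℚ.∣_∣ (*-regroup a b c d) ⟩
    ℚ.∣ a ℚ.* (b ℚ.- d) ℚ.+ d ℚ.* (a ℚ.- c) ∣
      ≤⟨ ℚ.∣p+q∣≤∣p∣+∣q∣ (a ℚ.* (b ℚ.- d)) (d ℚ.* (a ℚ.- c)) ⟩
    ℚ.∣ a ℚ.* (b ℚ.- d) ∣ ℚ.+ ℚ.∣ d ℚ.* (a ℚ.- c) ∣
      ≡⟨ cong₂ ℚ._+_ (ℚ.∣p*q∣≡∣p∣*∣q∣ a (b ℚ.- d)) (ℚ.∣p*q∣≡∣p∣*∣q∣ d (a ℚ.- c)) ⟩
    ℚ.∣ a ∣ ℚ.* ℚ.∣ b ℚ.- d ∣ ℚ.+ ℚ.∣ d ∣ ℚ.* ℚ.∣ a ℚ.- c ∣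
      <⟨ ℚ.+-mono-< (*-step a M₁ (b ℚ.- d) δ₁ M₁>0 a≤ bd<)
                    (*-step d M₂ (a ℚ.- c) δ₂ M₂>0 d≤ ac<) ⟩
    M₁ ℚ.* δ₁ ℚ.+ M₂ ℚ.* δ₂ ∎
    where open ℚ.≤-Reasoning

  *-cauchy : ∀ s t → IsCauchy s → IsCauchy t → IsCauchy (λ n → s n ℚ.* t n)
  *-cauchy s t cs ct ε ε>0 =
    let M₁ , M₁>0 , K₁ , b₁ = eventuallyBounded s cs
        M₂ , M₂>0 , K₂ , b₂ = eventuallyBounded t ct
        δ₁ , δ₁>0 , e₁      = scaled M₁>0 (half>0 ε>0)
        δ₂ , δ₂>0 , e₂      = scaled M₂>0 (half>0 ε>0)
        N₁ , h₁             = ct δ₁ δ₁>0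
        N₂ , h₂             = cs δ₂ δ₂>0
        K                   = K₁ ℕ.⊔ K₂
        N                   = N₁ ℕ.⊔ N₂
        total               = trans (cong₂ ℚ._+_ e₁ e₂) (halves ε)
    in K ℕ.⊔ N , λ m n m≥ n≥ →
      let mN = ℕ.m⊔n≤o⇒n≤o K N m≥
          nN = ℕ.m⊔n≤o⇒n≤o K N n≥
      in subst (ℚ.∣ s m ℚ.* t m ℚ.- s n ℚ.* t n ∣ ℚ.<_) total
           (*-bound (s m) (t m) (s n) (t n) M₁ M₂ δ₁ δ₂ M₁>0 M₂>0
             (b₁ m (ℕ.m⊔n≤o⇒m≤o K₁ K₂ (ℕ.m⊔n≤o⇒m≤o K N m≥)))
             (b₂ n (ℕ.m⊔n≤o⇒n≤o K₁ K₂ (ℕ.m⊔n≤o⇒m≤o K N n≥)))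
             (h₁ m n (ℕ.m⊔n≤o⇒m≤o N₁ N₂ mN) (ℕ.m⊔n≤o⇒m≤o N₁ N₂ nN))
             (h₂ m n (ℕ.m⊔n≤o⇒n≤o N₁ N₂ mN) (ℕ.m⊔n≤o⇒n≤o N₁ N₂ nN)))

infixl 6 _+_
infixl 7 _*_

_+_ : ℝ → ℝ → ℝ
seq    (x + y) n = seq x n ℚ.+ seq y n
cauchy (x + y)   = +-cauchy (seq x) (seq y) (cauchy x) (cauchy y)

_*_ : ℝ → ℝ → ℝ
seq    (x * y) n = seq x n ℚ.* seq y n
cauchy (x * y)   = *-cauchy (seq x) (seq y) (cauchy x) (cauchy y)

fromℚ : ℚ → ℝ
seq    (fromℚ q) _ = q
cauchy (fromℚ q)   = constCauchy q

0ℝ 1ℝ : ℝ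
0ℝ = fromℚ 0ℚ
1ℝ = fromℚ 1ℚ

ℝ-rawSemiring : RawSemiring 0ℓ 0ℓ
ℝ-rawSemiring = record
  { Carrier = ℝ ; _≈_ = _≈_ ; _+_ = _+_ ; _*_ = _*_ ; 0# = 0ℝ ; 1# = 1ℝ }

open RawSemiringDefinitions ℝ-rawSemiring public
  using (_^_; sum) renaming (_×_ to _·_)


-- The vertex set is Fin n, so both graphs in SpanningSubgraph have the same one.
record Graph (n : ℕ) : Set₁ where
  field
    Adj        : Rel (Fin n) 0ℓ
    adj?       : Decidable Adj
    adj-sym    : Symmetric Adj
    adj-irrefl : Irreflexive _≡_ Adj

open Graph public using (Adj; adj?; adj-sym; adj-irrefl)

SpanningSubgraph : ∀ {n} → Graph n → Graph n → Set
SpanningSubgraph H G = ∀ {u v} → Adj H u v → Adj G u v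

module _ {n} (G : Graph n) where

  IsClique : Pred (Subset n) 0ℓ
  IsClique K = ∀ u → u ∈ K → ∀ v → v ∈ K → u ≢ v → Adj G u v

  isClique? : U.Decidable IsClique
  isClique? K =
    all? λ u → (u ∈? K) →-dec
    all? λ v → (v ∈? K) →-dec (¬? (u ≟ᶠ v) →-dec adj? G u v)

subsets : ∀ n → List (Subset n)
subsets zero    = [] ∷ []
subsets (suc n) = map (outside ∷_) (subsets n) ++ map (inside ∷_) (subsets n)

module _ {n} (G : Graph n) (B : Subset n) where

  cliques : List (Subset n)
  cliques = filter (λ K → (K ⊆? B) ×-dec isClique? G K) (subsets n)

  cliqueCount : ℕ → ℕ
  cliqueCount i = length (filter (λ K → ∣ K ∣ ℕ.≟ i) cliques)

  -- ω(G[B]): a clique of the induced subgraph G[B] is a clique of G inside B.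
  ω : ℕ
  ω = max 0 (map ∣_∣ cliques)

  -- k · y is the k-fold sum y + ⋯ + y, so this is Σ_{i=0}^{ω} cᵢ(B) xⁱ.
  cliquePoly : ℝ → ℝ
  cliquePoly x = sum {suc ω} λ i → cliqueCount (toℕ i) · (x ^ toℕ i)

  NegativeRoot : Pred ℝ 0ℓ
  NegativeRoot x = x < 0ℝ × cliquePoly x ≈ 0ℝ

  -- IsZeta z says that z is the value of ζ_G(B) in ℝ ∪ {−∞}, with ⊥₋ as −∞.
  -- It is a relation because the case split on whether a root exists, and the
  -- choice of a largest one, are classical; z is unique up to _≈_.
  data IsZeta : ℝ ₋ → Set where
    noRoot  : Empty NegativeRoot → IsZeta ⊥₋
    maxRoot : ∀ {r} → NegativeRoot r → (∀ s → NegativeRoot s → s ≤ r) →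
              IsZeta [ r ]

open import Relation.Binary.Construct.Add.Infimum.NonStrict _≤_ public
  using (_≤₋_)

{-# OPTIONS --safe #-}

-- Write C_A(G; x) for the clique polynomial of A ⊆ B. Splitting off a vertex v ∈ A
-- gives C_A = C_{A∖v} + x C_{A∩N(v)}. Let x ≤ y ≤ 0, and suppose C_A(H; x) > 0 for all
-- A ⊆ B. Then A ↦ C_A(H; x) is antitone, and induction on A with the recurrence
-- shows that A ↦ C_A(G; y) / C_A(H; x) is monotone, the neighbourhoods in H being
-- smaller. Comparing with A = ∅ gives C_B(G; y) ≥ C_B(H; x) > 0. Hence if
-- G has a root r ∈ [q, 0), with q rational, positivity fails for H at q: some C_A(H; q) ≤ 0.
-- This failure is decidable at rational points and does not occur at 0, so bisection finds
-- where it stops. At a right end point C_B(H; ·) lies below the failing C_A(H; ·), which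
-- is ≤ 0 at the left end point, so by a Lipschitz bound C_B(H; ·) tends to 0:
-- the limit is a root of C_B(H; ·) in [q, 0).

module Submission where

open import Defs hiding (_≈_; _≤_; _<_; _+_; _*_; _^_; sum; _·_)
import Defs as Real
import Algebra.Definitions.RawSemiring as RawSemiringDefinitions
import Algebra.Properties.CommutativeMonoid.Sum as CommutativeMonoidSum
open import Data.Bool.Base using (true; false; if_then_else_)
open import Data.Fin.Base using (Fin; zero; suc; toℕ)
open import Data.Fin.Properties using (any?) renaming (_≟_ to _≟ᶠ_)
open import Data.Fin.Subset using (Subset; inside; outside; _∈_; _∉_; _⊆_; _⊂_; ⊥; _∩_) renaming (_-_ to _∖_; ∣_∣ to card)
open import Data.Fin.Subset.Induction using (⊂-wellFounded)
open import Data.Fin.Subset.Properties using (_∈?_; _⊆?_; ∉⊥; ⊥⊆; ∣⊥∣≡0; p─q⊆p; x∈p∩q⁺; x∈p∩q⁻; x∈p⇒p-x⊂p; x∈p∧x≢y⇒x∈p-y; x∈p⇒∣p-x∣<∣p∣; ⊆-antisym; ⊆-refl; ⊆-trans; anySubset?)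
import Data.Integer.Base as ℤ
import Data.Integer.Properties as ℤ
open import Data.List.Base using (List; []; _∷_; _++_; map; filter; length)
open import Data.List.Extrema.Nat using (xs≤max)
open import Data.List.Relation.Unary.All using (All; []; _∷_)
import Data.List.Relation.Unary.All.Properties as All
open import Data.Nat.Base as ℕ using (ℕ; zero; suc; z≤n; s≤s)
import Data.Nat.Properties as ℕ
open import Data.Product.Base using (∃-syntax; _×_; _,_; proj₁; proj₂)
open import Data.Rational.Base using (ℚ; 0ℚ; 1ℚ; ½; _+_; _*_; _-_; -_; ∣_∣; _≤_; _<_; mkℚ; 1/_; toℚᵘ; nonNegative; positive; NonZero) renaming (_/_ to _÷_; +-*-rawSemiring to ℚ-rawSemiring)
open import Data.Rational.Properties
open import Data.Rational.Solver using (module +-*-Solver)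
open import Data.Rational.Unnormalised.Base as ℚᵘ using (mkℚᵘ)
import Data.Rational.Unnormalised.Properties as ℚᵘ
open import Data.Sum.Base using (_⊎_; inj₁; inj₂)
open import Data.Vec.Base using ([]; _∷_; lookup; tabulate; _[_]≔_; here; there)
open import Data.Vec.Properties using (lookup∘tabulate; lookup⇒[]=; []=⇒lookup; []≔-updates; []≔-minimal; lookup∘update′)
open import Function.Base using (_∘_; case_of_)
open import Induction.WellFounded using (Acc; acc)
open import Relation.Binary.Construct.Add.Infimum.NonStrict Real._≤_ using (⊥₋≤_; [_])
open import Relation.Binary.PropositionalEquality
open import Relation.Nullary using (¬_; Dec; yes; no; does; contradiction)
open import Relation.Nullary.Construct.Add.Infimum using (_₋)
open import Relation.Nullary.Decidable using (_×-dec_; dec-true; dec-false; ¬?; decidable-stable)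
open import Relation.Unary using (Decidable; Pred)
open import Data.Empty using (⊥-elim)
open import Level using (0ℓ)

open RawSemiringDefinitions ℚ-rawSemiring using (_^_) renaming (_×_ to _·_)
open CommutativeMonoidSum +-0-commutativeMonoid using (sum; ∑-distrib-+; sum-cong-≗; sum-replicate-zero)

-- Ordered field arithmetic

private
  variable
    p q r s : ℚ

≤-gap : ∀ {d} → 0ℚ ≤ d → p + d ≡ q → p ≤ q
≤-gap {p} {d = d} 0≤d refl = subst (_≤ p + d) (+-identityʳ p) (+-monoʳ-≤ p 0≤d)

p≤q⇒0≤q-p : p ≤ q → 0ℚ ≤ q - p
p≤q⇒0≤q-p {p} {q} p≤q = subst (_≤ q - p) (+-inverseʳ p) (+-monoˡ-≤ (- p) p≤q)

0≤p+q : 0ℚ ≤ p → 0ℚ ≤ q → 0ℚ ≤ p + q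
0≤p+q = +-mono-≤

*-monoʳ : 0ℚ ≤ r → p ≤ q → p * r ≤ q * r
*-monoʳ {r} 0≤r = *-monoʳ-≤-nonNeg r {{nonNegative 0≤r}}

*-monoˡ : 0ℚ ≤ r → p ≤ q → r * p ≤ r * q
*-monoˡ {r} 0≤r = *-monoˡ-≤-nonNeg r {{nonNegative 0≤r}}

0≤p*q : 0ℚ ≤ p → 0ℚ ≤ q → 0ℚ ≤ p * q
0≤p*q {p} {q} 0≤p 0≤q = subst (_≤ p * q) (*-zeroˡ q) (*-monoʳ 0≤q 0≤p)

p≤0⇒0≤-p : p ≤ 0ℚ → 0ℚ ≤ - p
p≤0⇒0≤-p = neg-antimono-≤

*-mono-≤-nonNeg : 0ℚ ≤ q → 0ℚ ≤ r → p ≤ q → r ≤ s → p * r ≤ q * s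
*-mono-≤-nonNeg 0≤q 0≤r p≤q r≤s = ≤-trans (*-monoʳ 0≤r p≤q) (*-monoˡ 0≤q r≤s)

<⇒≱ : p < q → ¬ (q ≤ p)
<⇒≱ p<q q≤p = <-irrefl refl (<-≤-trans p<q q≤p)

p≤∣p∣ : ∀ p → p ≤ ∣ p ∣
p≤∣p∣ p with ≤-total 0ℚ p
... | inj₁ 0≤p = ≤-reflexive (sym (0≤p⇒∣p∣≡p 0≤p))
... | inj₂ p≤0 = ≤-trans p≤0 (0≤∣p∣ p)

∣p∣≤ : p ≤ r → - p ≤ r → ∣ p ∣ ≤ r
∣p∣≤ {p} p≤r -p≤r with ∣p∣≡p∨∣p∣≡-p p
... | inj₁ e = subst (_≤ _) (sym e) p≤r
... | inj₂ e = subst (_≤ _) (sym e) -p≤r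

p≤∣p-q∣+q : ∀ p q → p ≤ ∣ p - q ∣ + q
p≤∣p-q∣+q p q = subst (_≤ ∣ p - q ∣ + q) e (+-monoˡ-≤ q (p≤∣p∣ (p - q)))
  where
  e : (p - q) + q ≡ p
  e = solve 2 (λ p q → (p :- q) :+ q := p) refl p q
    where open +-*-Solver

-- Finite sums over lists

private
  variable
    A C : Set

∑ₗ : (A → ℚ) → List A → ℚ
∑ₗ f []       = 0ℚ
∑ₗ f (a ∷ as) = f a + ∑ₗ f as

∑ₗ-cong : {f g : A → ℚ} → (∀ a → f a ≡ g a) → ∀ as → ∑ₗ f as ≡ ∑ₗ g as
∑ₗ-cong f≗g []       = refl
∑ₗ-cong f≗g (a ∷ as) = cong₂ _+_ (f≗g a) (∑ₗ-cong f≗g as)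

∑ₗ-++ : ∀ (f : A → ℚ) as bs → ∑ₗ f (as ++ bs) ≡ ∑ₗ f as + ∑ₗ f bs
∑ₗ-++ f []       bs = sym (+-identityˡ _)
∑ₗ-++ f (a ∷ as) bs = trans (cong (f a +_) (∑ₗ-++ f as bs)) (sym (+-assoc (f a) (∑ₗ f as) (∑ₗ f bs)))

∑ₗ-map : ∀ (f : C → ℚ) (g : A → C) as → ∑ₗ f (map g as) ≡ ∑ₗ (f ∘ g) as
∑ₗ-map f g []       = refl
∑ₗ-map f g (a ∷ as) = cong (f (g a) +_) (∑ₗ-map f g as)

∑ₗ-zero : {f : A → ℚ} → (∀ a → f a ≡ 0ℚ) → ∀ as → ∑ₗ f as ≡ 0ℚ
∑ₗ-zero f≗0 []       = refl
∑ₗ-zero f≗0 (a ∷ as) = cong₂ _+_ (f≗0 a) (∑ₗ-zero f≗0 as)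

+-interchange : ∀ a b c d → (a + b) + (c + d) ≡ (a + c) + (b + d)
+-interchange = solve 4 (λ a b c d → (a :+ b) :+ (c :+ d) := (a :+ c) :+ (b :+ d)) refl
  where open +-*-Solver

∑ₗ-+ : ∀ (f g : A → ℚ) as → ∑ₗ (λ a → f a + g a) as ≡ ∑ₗ f as + ∑ₗ g as
∑ₗ-+ f g []       = refl
∑ₗ-+ f g (a ∷ as) =
  trans (cong (f a + g a +_) (∑ₗ-+ f g as)) (+-interchange (f a) (g a) (∑ₗ f as) (∑ₗ g as))

∑ₗ-*ˡ : ∀ c (f : A → ℚ) as → ∑ₗ (λ a → c * f a) as ≡ c * ∑ₗ f as
∑ₗ-*ˡ c f []       = sym (*-zeroʳ c)
∑ₗ-*ˡ c f (a ∷ as) = trans (cong (c * f a +_) (∑ₗ-*ˡ c f as)) (sym (*-distribˡ-+ c (f a) (∑ₗ f as)))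

∑ₗ-≥0 : {f : A → ℚ} → (∀ a → 0ℚ ≤ f a) → ∀ as → 0ℚ ≤ ∑ₗ f as
∑ₗ-≥0 0≤f []       = ≤-refl
∑ₗ-≥0 0≤f (a ∷ as) = 0≤p+q (0≤f a) (∑ₗ-≥0 0≤f as)

-- The branch is on `does`, so a `with` on that Boolean alone reduces a term; sums over cliques
-- thereby become sums over all subsets.
indicator : ∀ {P : Set} → Dec P → ℚ → ℚ
indicator P? q = if does P? then q else 0ℚ

indicator-yes : ∀ {P : Set} (P? : Dec P) → P → ∀ q → indicator P? q ≡ q
indicator-yes P? p q = cong (if_then q else 0ℚ) (dec-true P? p)

indicator-no : ∀ {P : Set} (P? : Dec P) → ¬ P → ∀ q → indicator P? q ≡ 0ℚ
indicator-no P? ¬p q = cong (if_then q else 0ℚ) (dec-false P? ¬p)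

indicator-cong : ∀ {P Q : Set} (P? : Dec P) (Q? : Dec Q) →
  (P → Q) → (Q → P) → ∀ q → indicator P? q ≡ indicator Q? q
indicator-cong (yes p) Q? P⇒Q Q⇒P q = sym (indicator-yes Q? (P⇒Q p) q)
indicator-cong (no ¬p) Q? P⇒Q Q⇒P q = sym (indicator-no Q? (¬p ∘ Q⇒P) q)

indicator-*ˡ : ∀ {P : Set} (P? : Dec P) c q → indicator P? (c * q) ≡ c * indicator P? q
indicator-*ˡ (yes _) c q = refl
indicator-*ˡ (no _)  c q = sym (*-zeroʳ c)

∑ₗ-filter : ∀ {P : Pred A 0ℓ} (P? : Decidable P) (f : A → ℚ) as →
  ∑ₗ f (filter P? as) ≡ ∑ₗ (λ a → indicator (P? a) (f a)) as
∑ₗ-filter P? f []       = refl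
∑ₗ-filter P? f (a ∷ as) with does (P? a)
... | true  = cong (f a +_) (∑ₗ-filter P? f as)
... | false = trans (∑ₗ-filter P? f as) (sym (+-identityˡ _))

sum-indicator : ∀ (w : ℕ → ℚ) {k m} → k ℕ.< m →
  sum {m} (λ i → indicator (k ℕ.≟ toℕ i) (w (toℕ i))) ≡ w k
sum-indicator w {zero}  {suc m} _         =
  trans (cong (w 0 +_) (sum-replicate-zero m)) (+-identityʳ _)
sum-indicator w {suc k} {suc m} (s≤s k<m) =
  trans (+-identityˡ _) (sum-indicator (w ∘ suc) k<m)

length-filter-· : ∀ {P : Pred A 0ℓ} (P? : Decidable P) a as x →
  length (filter P? (a ∷ as)) · x ≡ indicator (P? a) x + length (filter P? as) · x
length-filter-· P? a as x with does (P? a)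
... | true  = refl
... | false = sym (+-identityˡ _)

-- Double counting: each `a` contributes `w (size a)` to exactly one coefficient, and the bound `m`
-- ensures that its index occurs. This converts a polynomial given by coefficients into a sum over
-- cliques.
∑ₗ-by-size : ∀ (size : A → ℕ) (w : ℕ → ℚ) m as → All (λ a → size a ℕ.≤ m) as →
  sum {suc m} (λ i → length (filter (λ a → size a ℕ.≟ toℕ i) as) · w (toℕ i)) ≡ ∑ₗ (w ∘ size) as
∑ₗ-by-size size w m []       []             = sum-replicate-zero (suc m)
∑ₗ-by-size size w m (a ∷ as) (a≤m ∷ as≤m) = begin
  sum {suc m} (λ i → count (a ∷ as) i · w (toℕ i))
    ≡⟨ sum-cong-≗ {suc m} (λ i → length-filter-· (λ b → size b ℕ.≟ toℕ i) a as (w (toℕ i))) ⟩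
  sum {suc m} (λ i → indicator (size a ℕ.≟ toℕ i) (w (toℕ i)) + count as i · w (toℕ i))
    ≡⟨ ∑-distrib-+ {suc m} (λ i → indicator (size a ℕ.≟ toℕ i) (w (toℕ i))) (λ i → count as i · w (toℕ i)) ⟩
  sum {suc m} (λ i → indicator (size a ℕ.≟ toℕ i) (w (toℕ i))) + sum {suc m} (λ i → count as i · w (toℕ i))
    ≡⟨ cong₂ _+_ (sum-indicator w (s≤s a≤m)) (∑ₗ-by-size size w m as as≤m) ⟩
  w (size a) + ∑ₗ (w ∘ size) as ∎
  where
  open ≡-Reasoning
  count : List _ → Fin (suc m) → ℕ
  count bs i = length (filter (λ b → size b ℕ.≟ toℕ i) bs)

-- Sums over all subsets

∑-subsets-suc : ∀ {n} (f : Subset (suc n) → ℚ) →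
  ∑ₗ f (subsets (suc n)) ≡ ∑ₗ (λ K → f (outside ∷ K) + f (inside ∷ K)) (subsets n)
∑-subsets-suc {n} f = begin
  ∑ₗ f (map (outside ∷_) (subsets n) ++ map (inside ∷_) (subsets n))
    ≡⟨ ∑ₗ-++ f (map (outside ∷_) (subsets n)) _ ⟩
  ∑ₗ f (map (outside ∷_) (subsets n)) + ∑ₗ f (map (inside ∷_) (subsets n))
    ≡⟨ cong₂ _+_ (∑ₗ-map f _ (subsets n)) (∑ₗ-map f _ (subsets n)) ⟩
  ∑ₗ (f ∘ (outside ∷_)) (subsets n) + ∑ₗ (f ∘ (inside ∷_)) (subsets n)
    ≡⟨ ∑ₗ-+ (f ∘ (outside ∷_)) (f ∘ (inside ∷_)) (subsets n) ⟨
  ∑ₗ (λ K → f (outside ∷ K) + f (inside ∷ K)) (subsets n) ∎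
  where open ≡-Reasoning

-- Each subset avoiding `v` is paired with the one obtained by adding `v`. The value 0 at the
-- subsets containing `v` keeps the index set unchanged.
∑-subsets-insert : ∀ {n} (v : Fin n) (f : Subset n → ℚ) →
  ∑ₗ f (subsets n) ≡
  ∑ₗ (λ K → if lookup K v then 0ℚ else f K + f (K [ v ]≔ inside)) (subsets n)
∑-subsets-insert {suc n} zero f =
  trans (∑-subsets-suc f)
    (trans (∑ₗ-cong (λ K → sym (+-identityʳ (f (outside ∷ K) + f (inside ∷ K)))) (subsets n))
      (sym (∑-subsets-suc (λ K → if lookup K zero then 0ℚ else f K + f (K [ zero ]≔ inside)))))
∑-subsets-insert {suc n} (suc v) f = begin
  ∑ₗ f (subsets (suc n))
    ≡⟨ ∑-subsets-suc f ⟩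
  ∑ₗ (λ K → f (outside ∷ K) + f (inside ∷ K)) (subsets n)
    ≡⟨ ∑-subsets-insert v (λ K → f (outside ∷ K) + f (inside ∷ K)) ⟩
  ∑ₗ (λ K → if lookup K v then 0ℚ else
    (f (outside ∷ K) + f (inside ∷ K)) + (f (outside ∷ (K [ v ]≔ inside)) + f (inside ∷ (K [ v ]≔ inside))))
    (subsets n)
    ≡⟨ ∑ₗ-cong (λ K → split (lookup K v) (f (outside ∷ K)) (f (inside ∷ K))
         (f (outside ∷ (K [ v ]≔ inside))) (f (inside ∷ (K [ v ]≔ inside)))) (subsets n) ⟩
  ∑ₗ (λ K → g (outside ∷ K) + g (inside ∷ K)) (subsets n)
    ≡⟨ ∑-subsets-suc g ⟨
  ∑ₗ g (subsets (suc n)) ∎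
  where
  open ≡-Reasoning
  g : Subset (suc n) → ℚ
  g K = if lookup K (suc v) then 0ℚ else f K + f (K [ suc v ]≔ inside)
  split : ∀ b x y z w → (if b then 0ℚ else (x + y) + (z + w)) ≡
    (if b then 0ℚ else x + z) + (if b then 0ℚ else y + w)
  split true  x y z w = refl
  split false x y z w = +-interchange x y z w

-- Serves the two cases in which only the empty clique survives: the vertex set `⊥` and the point 0.
∑-subsets-⊥ : ∀ {n} (f : Subset n → ℚ) → (∀ {K v} → v ∈ K → f K ≡ 0ℚ) →
  ∑ₗ f (subsets n) ≡ f ⊥
∑-subsets-⊥ {zero}  f f≡0 = +-identityʳ _
∑-subsets-⊥ {suc n} f f≡0 = begin
  ∑ₗ f (subsets (suc n))
    ≡⟨ ∑-subsets-suc f ⟩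
  ∑ₗ (λ K → f (outside ∷ K) + f (inside ∷ K)) (subsets n)
    ≡⟨ ∑ₗ-cong (λ K → trans (cong (f (outside ∷ K) +_) (f≡0 here)) (+-identityʳ (f (outside ∷ K)))) (subsets n) ⟩
  ∑ₗ (f ∘ (outside ∷_)) (subsets n)
    ≡⟨ ∑-subsets-⊥ (f ∘ (outside ∷_)) (f≡0 ∘ there) ⟩
  f ⊥ ∎
  where open ≡-Reasoning

v∈insert : ∀ {n} (K : Subset n) v → v ∈ K [ v ]≔ inside
v∈insert = []≔-updates

⊆-insert : ∀ {n} (K : Subset n) v → K ⊆ K [ v ]≔ inside
⊆-insert K v {u} u∈K with u ≟ᶠ v
... | yes refl = v∈insert K v
... | no  u≢v  = []≔-minimal K u v u≢v u∈K

∈-insert⁻ : ∀ {n} (K : Subset n) v {u} → u ∈ K [ v ]≔ inside → u ≡ v ⊎ u ∈ K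
∈-insert⁻ K v {u} u∈ with u ≟ᶠ v
... | yes u≡v = inj₁ u≡v
... | no  u≢v = inj₂ (lookup⇒[]= u K (trans (sym (lookup∘update′ u≢v K inside)) ([]=⇒lookup u∈)))

card-insert : ∀ {n} (K : Subset n) v → lookup K v ≡ outside → card (K [ v ]≔ inside) ≡ suc (card K)
card-insert (outside ∷ K) zero    _   = refl
card-insert (outside ∷ K) (suc v) v∉K = card-insert K v v∉K
card-insert (inside  ∷ K) (suc v) v∉K = cong suc (card-insert K v v∉K)

v∉p∖v : ∀ {n} (p : Subset n) v → v ∉ p ∖ v
v∉p∖v (_ ∷ p) zero    ()
v∉p∖v (_ ∷ p) (suc v) (there v∈) = v∉p∖v p v v∈

-- The clique polynomial at rational points

module _ {n} (G : Graph n) where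

  cliqueIn? : ∀ A K → Dec (K ⊆ A × IsClique G K)
  cliqueIn? A K = (K ⊆? A) ×-dec isClique? G K

  cliqueTerm : Subset n → ℚ → Subset n → ℚ
  cliqueTerm A x K = indicator (cliqueIn? A K) (x ^ card K)

  -- Summing over cliques instead of degrees suits the recurrence, which is a bijection between
  -- cliques. Rational arguments make signs decidable.
  poly : Subset n → ℚ → ℚ
  poly A x = ∑ₗ (cliqueTerm A x) (subsets n)

  neighbours : Fin n → Subset n
  neighbours v = tabulate (λ u → does (adj? G v u))

  ∈-neighbours⁺ : ∀ {v u} → Adj G v u → u ∈ neighbours v
  ∈-neighbours⁺ {v} {u} vu = lookup⇒[]= u _
    (trans (lookup∘tabulate _ u) (dec-true (adj? G v u) vu))

  ∈-neighbours⁻ : ∀ {v u} → u ∈ neighbours v → Adj G v u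
  ∈-neighbours⁻ {v} {u} u∈ with adj? G v u in eq
  ... | yes vu = vu
  ... | no  _  = case trans (sym ([]=⇒lookup u∈)) (trans (lookup∘tabulate _ u) (cong does eq)) of λ ()

  v∉neighbours : ∀ v → v ∉ neighbours v
  v∉neighbours v v∈ = adj-irrefl G refl (∈-neighbours⁻ v∈)

  poly-⊥ : ∀ x → poly ⊥ x ≡ 1ℚ
  poly-⊥ x = begin
    poly ⊥ x
      ≡⟨ ∑-subsets-⊥ (cliqueTerm ⊥ x) (λ {K} v∈K → indicator-no (cliqueIn? ⊥ K) (λ c → ∉⊥ (proj₁ c v∈K)) _) ⟩
    cliqueTerm ⊥ x ⊥
      ≡⟨ indicator-yes (cliqueIn? ⊥ ⊥) (⊆-refl , λ _ u∈⊥ → contradiction u∈⊥ ∉⊥) _ ⟩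
    x ^ card {n} ⊥
      ≡⟨ cong (x ^_) (∣⊥∣≡0 n) ⟩
    1ℚ ∎
    where open ≡-Reasoning

  poly-at-0 : ∀ A → poly A 0ℚ ≡ 1ℚ
  poly-at-0 A = begin
    poly A 0ℚ
      ≡⟨ ∑-subsets-⊥ (cliqueTerm A 0ℚ) vanish ⟩
    cliqueTerm A 0ℚ ⊥
      ≡⟨ indicator-yes (cliqueIn? A ⊥) (⊥⊆ , λ _ u∈⊥ → contradiction u∈⊥ ∉⊥) _ ⟩
    0ℚ ^ card {n} ⊥
      ≡⟨ cong (0ℚ ^_) (∣⊥∣≡0 n) ⟩
    1ℚ ∎
    where
    open ≡-Reasoning
    vanish : ∀ {K v} → v ∈ K → cliqueTerm A 0ℚ K ≡ 0ℚ
    -- Abstracting `card K` together with the fact that it is positive excludes the exponent 0,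
    -- where the power would be 1.
    vanish {K} v∈K with card K | ℕ.≤-<-trans z≤n (x∈p⇒∣p-x∣<∣p∣ v∈K)
    ... | suc m | _ with does (cliqueIn? A K)
    ...   | true  = *-zeroˡ (0ℚ ^ m)
    ...   | false = refl

  -- A clique in `A` either avoids `v`, or is `v` added to a unique clique among its neighbours in
  -- `A`, which raises the degree by one.
  poly-rec : ∀ {A v} → v ∈ A → ∀ x →
    poly A x ≡ poly (A ∖ v) x + x * poly (A ∩ neighbours v) x
  poly-rec {A} {v} v∈A x = begin
    ∑ₗ (cliqueTerm A x) (subsets n)
      ≡⟨ ∑-subsets-insert v (cliqueTerm A x) ⟩
    ∑ₗ (λ K → if lookup K v then 0ℚ else cliqueTerm A x K + cliqueTerm A x (K [ v ]≔ inside)) (subsets n)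
      ≡⟨ ∑ₗ-cong pointwise (subsets n) ⟩
    ∑ₗ (λ K → cliqueTerm A₁ x K + x * cliqueTerm A₂ x K) (subsets n)
      ≡⟨ ∑ₗ-+ (cliqueTerm A₁ x) (λ K → x * cliqueTerm A₂ x K) (subsets n) ⟩
    poly A₁ x + ∑ₗ (λ K → x * cliqueTerm A₂ x K) (subsets n)
      ≡⟨ cong (poly A₁ x +_) (∑ₗ-*ˡ x (cliqueTerm A₂ x) (subsets n)) ⟩
    poly A₁ x + x * poly A₂ x ∎
    where
    open ≡-Reasoning
    A₁ A₂ : Subset n
    A₁ = A ∖ v
    A₂ = A ∩ neighbours v

    v∉A₂ : v ∉ A₂
    v∉A₂ v∈A₂ = v∉neighbours v (proj₂ (x∈p∩q⁻ A _ v∈A₂))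

    without : ∀ {K} → v ∉ K → cliqueTerm A x K ≡ cliqueTerm A₁ x K
    without {K} v∉K = indicator-cong (cliqueIn? A K) (cliqueIn? A₁ K)
      (λ (K⊆A , cl) → (λ u∈K → x∈p∧x≢y⇒x∈p-y (K⊆A u∈K) (λ { refl → v∉K u∈K })) , cl)
      (λ (K⊆A₁ , cl) → (λ u∈K → p─q⊆p A _ (K⊆A₁ u∈K)) , cl) _

    clique⁻ : ∀ {K} → v ∉ K → (K [ v ]≔ inside) ⊆ A × IsClique G (K [ v ]≔ inside) →
      K ⊆ A₂ × IsClique G K
    clique⁻ {K} v∉K (K′⊆A , cl) =
      (λ {u} u∈K → x∈p∩q⁺ (K′⊆A (⊆-insert K v u∈K) ,
        ∈-neighbours⁺ (cl v (v∈insert K v) u (⊆-insert K v u∈K) (λ { refl → v∉K u∈K })))) ,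
      λ u u∈K w w∈K → cl u (⊆-insert K v u∈K) w (⊆-insert K v w∈K)

    clique⁺ : ∀ {K} → K ⊆ A₂ × IsClique G K →
      (K [ v ]≔ inside) ⊆ A × IsClique G (K [ v ]≔ inside)
    clique⁺ {K} (K⊆A₂ , cl) = K′⊆A , cl′
      where
      adj : ∀ {u} → u ∈ K → Adj G v u
      adj u∈K = ∈-neighbours⁻ (proj₂ (x∈p∩q⁻ A _ (K⊆A₂ u∈K)))
      K′⊆A : (K [ v ]≔ inside) ⊆ A
      K′⊆A u∈ with ∈-insert⁻ K v u∈
      ... | inj₁ refl = v∈A
      ... | inj₂ u∈K  = proj₁ (x∈p∩q⁻ A _ (K⊆A₂ u∈K))
      cl′ : IsClique G (K [ v ]≔ inside)
      cl′ u u∈ w w∈ u≢w with ∈-insert⁻ K v u∈ | ∈-insert⁻ K v w∈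
      ... | inj₁ refl | inj₁ refl = contradiction refl u≢w
      ... | inj₁ refl | inj₂ w∈K  = adj w∈K
      ... | inj₂ u∈K  | inj₁ refl = adj-sym G (adj u∈K)
      ... | inj₂ u∈K  | inj₂ w∈K  = cl u u∈K w w∈K u≢w

    withV : ∀ {K} → lookup K v ≡ outside → v ∉ K →
      cliqueTerm A x (K [ v ]≔ inside) ≡ x * cliqueTerm A₂ x K
    withV {K} K[v] v∉K = begin
      indicator (cliqueIn? A (K [ v ]≔ inside)) (x ^ card (K [ v ]≔ inside))
        ≡⟨ cong (indicator (cliqueIn? A (K [ v ]≔ inside)) ∘ (x ^_)) (card-insert K v K[v]) ⟩
      indicator (cliqueIn? A (K [ v ]≔ inside)) (x * x ^ card K)
        ≡⟨ indicator-cong (cliqueIn? A (K [ v ]≔ inside)) (cliqueIn? A₂ K) (clique⁻ v∉K) clique⁺ _ ⟩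
      indicator (cliqueIn? A₂ K) (x * x ^ card K)
        ≡⟨ indicator-*ˡ (cliqueIn? A₂ K) x _ ⟩
      x * cliqueTerm A₂ x K ∎

    pointwise : ∀ K →
      (if lookup K v then 0ℚ else cliqueTerm A x K + cliqueTerm A x (K [ v ]≔ inside)) ≡
      cliqueTerm A₁ x K + x * cliqueTerm A₂ x K
    pointwise K with lookup K v in eq
    ... | false = cong₂ _+_ (without v∉K) (withV eq v∉K)
      where
      v∉K : v ∉ K
      v∉K v∈K = case trans (sym eq) ([]=⇒lookup v∈K) of λ ()
    -- A set containing `v` lies neither in `A₁` nor in `A₂`, so both terms on the right vanish.
    ... | true  = sym (trans
      (cong₂ (λ a b → a + x * b)
        (indicator-no (cliqueIn? A₁ K) (λ c → v∉p∖v A v (proj₁ c v∈K)) _)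
        (indicator-no (cliqueIn? A₂ K) (λ c → v∉A₂ (proj₁ c v∈K)) _))
      (trans (+-identityˡ _) (*-zeroʳ x)))
      where
      v∈K : v ∈ K
      v∈K = lookup⇒[]= v K eq

-- Termwise evaluation of the real clique polynomial

seq-sum : ∀ {k} (f : Fin k → ℝ) m → seq (Real.sum f) m ≡ sum (λ i → seq (f i) m)
seq-sum {zero}  f m = refl
seq-sum {suc k} f m = cong (seq (f zero) m +_) (seq-sum (f ∘ suc) m)

seq-· : ∀ k x m → seq (k Real.· x) m ≡ k · seq x m
seq-· zero    x m = refl
seq-· (suc k) x m = cong (seq x m +_) (seq-· k x m)

seq-^ : ∀ x k m → seq (x Real.^ k) m ≡ seq x m ^ k
seq-^ x zero    m = refl
seq-^ x (suc k) m = cong (seq x m *_) (seq-^ x k m)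

-- The real operations act termwise, so questions about real roots become questions about rational
-- values along the sequence.
seq-cliquePoly : ∀ {n} (G : Graph n) B x m → seq (cliquePoly G B x) m ≡ poly G B (seq x m)
seq-cliquePoly {n} G B x m = begin
  seq (cliquePoly G B x) m
    ≡⟨ seq-sum {suc (ω G B)} (λ i → cliqueCount G B (toℕ i) Real.· (x Real.^ toℕ i)) m ⟩
  sum {suc (ω G B)} (λ i → seq (cliqueCount G B (toℕ i) Real.· (x Real.^ toℕ i)) m)
    ≡⟨ sum-cong-≗ {suc (ω G B)} (λ i → trans (seq-· (cliqueCount G B (toℕ i)) (x Real.^ toℕ i) m)
         (cong (cliqueCount G B (toℕ i) ·_) (seq-^ x (toℕ i) m))) ⟩
  sum {suc (ω G B)} (λ i → cliqueCount G B (toℕ i) · (seq x m ^ toℕ i))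
    -- No clique in `B` has more than `ω` vertices, so the degrees up to `ω` reach them all.
    ≡⟨ ∑ₗ-by-size card (seq x m ^_) (ω G B) (cliques G B) (All.map⁻ (xs≤max 0 (map card (cliques G B)))) ⟩
  ∑ₗ (λ K → seq x m ^ card K) (cliques G B)
    ≡⟨ ∑ₗ-filter (cliqueIn? G B) (λ K → seq x m ^ card K) (subsets n) ⟩
  poly G B (seq x m) ∎
  where open ≡-Reasoning

-- Drives the inductions below: vertices outside `D` are removed from `A` one at a time until `D` is
-- reached.
⊆-cases : ∀ {n} {D A : Subset n} → D ⊆ A → D ≡ A ⊎ ∃[ v ] (v ∈ A × D ⊆ A ∖ v)
⊆-cases {D = D} {A} D⊆A with any? (λ v → (v ∈? A) ×-dec ¬? (v ∈? D))
... | yes (v , v∈A , v∉D) = inj₂ (v , v∈A , λ u∈D → x∈p∧x≢y⇒x∈p-y (D⊆A u∈D) (λ { refl → v∉D u∈D }))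
... | no  none            = inj₁ (⊆-antisym D⊆A (λ {v} v∈A →
  decidable-stable (v ∈? D) (λ v∉D → none (v , v∈A , v∉D))))

-- Comparison of a graph with a spanning subgraph

module _ {n} (G : Graph n) (B : Subset n) where

  -- Failure of positivity on some subset of `B`, not just on `B`, because the recurrence leads to
  -- smaller vertex sets. It is decidable, as there are finitely many subsets and the point is
  -- rational.
  Bad : Pred ℚ 0ℓ
  Bad x = ∃[ A ] (A ⊆ B × poly G A x ≤ 0ℚ)

  bad? : Decidable Bad
  bad? x = anySubset? (λ A → (A ⊆? B) ×-dec (poly G A x ≤? 0ℚ))

  module _ {x} (x≤0 : x ≤ 0ℚ) (good : ¬ Bad x) where

    poly-positive : ∀ {A} → A ⊆ B → 0ℚ < poly G A x
    poly-positive A⊆B = ≰⇒> (λ p≤0 → good (_ , A⊆B , p≤0))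

    private
      -- By `poly-rec`, removing a vertex adds `- x` times a positive value, and `- x` is
      -- nonnegative.
      antitone : ∀ {D A} → Acc _⊂_ A → D ⊆ A → A ⊆ B → poly G A x ≤ poly G D x
      antitone {D} {A} (acc rec) D⊆A A⊆B with ⊆-cases D⊆A
      ... | inj₁ refl               = ≤-refl
      ... | inj₂ (v , v∈A , D⊆A∖v) = ≤-trans remove
        (antitone (rec (x∈p⇒p-x⊂p v∈A)) D⊆A∖v (λ u∈ → A⊆B (p─q⊆p A _ u∈)))
        where
        a b : ℚ
        a = poly G (A ∖ v) x
        b = poly G (A ∩ neighbours G v) x
        remove : poly G A x ≤ a
        remove = ≤-gap
          (0≤p*q (p≤0⇒0≤-p x≤0) (<⇒≤ (poly-positive (λ u∈ → A⊆B (proj₁ (x∈p∩q⁻ A _ u∈))))))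
          (trans (cong (_+ - x * b) (poly-rec G v∈A x))
            (solve 3 (λ a b x → (a :+ x :* b) :+ (:- x) :* b := a) refl a b x))
          where open +-*-Solver

    poly-antitone : ∀ {D A} → D ⊆ A → A ⊆ B → poly G A x ≤ poly G D x
    poly-antitone = antitone (⊂-wellFounded _)

module _ {n} (G H : Graph n) (H⊆G : SpanningSubgraph H G) (B : Subset n)
         {x y} (x≤y : x ≤ y) (y≤0 : y ≤ 0ℚ) (good : ¬ Bad H B x) where

  private
    x≤0 : x ≤ 0ℚ
    x≤0 = ≤-trans x≤y y≤0

    g h : Subset n → ℚ
    g A = poly G A y
    h A = poly H A x

    h>0 : ∀ {A} → A ⊆ B → 0ℚ < h A
    h>0 = poly-positive H B x≤0 good

    -- Both polynomials equal 1 at `⊥`, so comparing ratios with the empty set compares the values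
    -- themselves.
    h≤g : ∀ {A} → g ⊥ * h A ≤ g A * h ⊥ → h A ≤ g A
    h≤g {A} = subst₂ _≤_
      (trans (cong (_* h A) (poly-⊥ G y)) (*-identityˡ _))
      (trans (cong (g A *_) (poly-⊥ H x)) (*-identityʳ _))

    -- Monotonicity of `g / h`, cross-multiplied to avoid division. The induction hypothesis takes
    -- `D` to `A′`, `remove` takes `A′` to `A`, and the two are chained by cancelling `h A′ > 0`.
    ratio : ∀ {A} → Acc _⊂_ A → A ⊆ B → ∀ {D} → D ⊆ A → g D * h A ≤ g A * h D
    ratio {A} (acc rec) A⊆B {D} D⊆A with ⊆-cases D⊆A
    ... | inj₁ refl               = ≤-refl
    ... | inj₂ (v , v∈A , D⊆A∖v) = *-cancelʳ-≤-pos (h A′) {{positive (h>0 A′⊆B)}} (begin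
        (g D * h A) * h A′
          ≡⟨ swap (g D) (h A) (h A′) ⟩
        (g D * h A′) * h A
          ≤⟨ *-monoʳ (<⇒≤ (h>0 A⊆B)) (IH D⊆A∖v) ⟩
        (g A′ * h D) * h A
          ≡⟨ swap (g A′) (h D) (h A) ⟩
        (g A′ * h A) * h D
          ≤⟨ *-monoʳ (<⇒≤ (h>0 (⊆-trans D⊆A A⊆B))) remove ⟩
        (g A * h A′) * h D
          ≡⟨ swap (g A) (h A′) (h D) ⟩
        (g A * h D) * h A′ ∎)
      where
      open ≤-Reasoning

      swap : ∀ a b c → (a * b) * c ≡ (a * c) * b
      swap = solve 3 (λ a b c → (a :* b) :* c := (a :* c) :* b) refl
        where open +-*-Solver

      A′ N M : Subset n
      A′ = A ∖ v
      N  = A ∩ neighbours G v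
      M  = A ∩ neighbours H v

      A′⊆B : A′ ⊆ B
      A′⊆B u∈ = A⊆B (p─q⊆p A _ u∈)

      IH : ∀ {D} → D ⊆ A′ → g D * h A′ ≤ g A′ * h D
      IH = ratio (rec (x∈p⇒p-x⊂p v∈A)) A′⊆B

      N⊆A′ : N ⊆ A′
      N⊆A′ u∈N = let u∈A , u∈nbr = x∈p∩q⁻ A _ u∈N in
        x∈p∧x≢y⇒x∈p-y u∈A (λ { refl → v∉neighbours G v u∈nbr })

      M⊆N : M ⊆ N
      M⊆N u∈M = let u∈A , u∈nbr = x∈p∩q⁻ A _ u∈M in
        x∈p∩q⁺ (u∈A , ∈-neighbours⁺ G (H⊆G (∈-neighbours⁻ H u∈nbr)))

      -- Positivity is assumed for `H` at `x` only; for `G` at `y` it comes from the induction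
      -- hypothesis at `⊥`.
      0≤gA′ : 0ℚ ≤ g A′
      0≤gA′ = ≤-trans (<⇒≤ (h>0 A′⊆B)) (h≤g {A′} (IH ⊥⊆))

      N⊆B : N ⊆ B
      N⊆B u∈ = A′⊆B (N⊆A′ u∈)

      -- The gap splits into three parts, each nonnegative where it is used: the induction
      -- hypothesis for `N ⊆ A′`, the move from `x` to `y`, and antitonicity of `h` for `M ⊆ N`.
      -- Only the last compares the neighbourhoods in the two graphs.
      identity : ∀ x y g′ gN h′ hN hM →
        g′ * (h′ + x * hM) +
          ((- y * (g′ * hN - gN * h′) + (y - x) * (g′ * hN)) + - x * (g′ * (hM - hN)))
        ≡ (g′ + y * gN) * h′
      identity = solve 7 (λ x y g′ gN h′ hN hM →
        g′ :* (h′ :+ x :* hM) :+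
          (((:- y) :* (g′ :* hN :- gN :* h′) :+ (y :- x) :* (g′ :* hN)) :+ (:- x) :* (g′ :* (hM :- hN)))
        := (g′ :+ y :* gN) :* h′) refl
        where open +-*-Solver

      remove : g A′ * h A ≤ g A * h A′
      remove = subst₂ (λ hA gA → g A′ * hA ≤ gA * h A′)
        (sym (poly-rec H v∈A x)) (sym (poly-rec G v∈A y))
        (≤-gap
          (0≤p+q
            (0≤p+q
              (0≤p*q (p≤0⇒0≤-p y≤0) (p≤q⇒0≤q-p (IH N⊆A′)))
              (0≤p*q (p≤q⇒0≤q-p x≤y) (0≤p*q 0≤gA′ (<⇒≤ (h>0 N⊆B)))))
            (0≤p*q (p≤0⇒0≤-p x≤0)
              (0≤p*q 0≤gA′ (p≤q⇒0≤q-p (poly-antitone H B x≤0 good M⊆N N⊆B)))))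
          (identity x y (g A′) (g N) (h A′) (h N) (h M)))

  poly-mono-graph : poly H B x ≤ poly G B y
  poly-mono-graph = h≤g {B} (ratio (⊂-wellFounded B) ⊆-refl ⊥⊆)

-- Lipschitz bounds

-- This is k M^(k-1), the Lipschitz constant of the k-th power on [-M, M], in the recursive form
-- that the product rule produces.
lip : ℚ → ℕ → ℚ
lip M zero    = 0ℚ
lip M (suc k) = M * lip M k + M ^ k

module _ {M : ℚ} (0≤M : 0ℚ ≤ M) where

  0≤^ : ∀ k → 0ℚ ≤ M ^ k
  0≤^ zero    = <⇒≤ (positive⁻¹ 1ℚ)
  0≤^ (suc k) = 0≤p*q 0≤M (0≤^ k)

  0≤lip : ∀ k → 0ℚ ≤ lip M k
  0≤lip zero    = ≤-refl
  0≤lip (suc k) = 0≤p+q (0≤p*q 0≤M (0≤lip k)) (0≤^ k)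

  ^-bound : ∀ {x} → ∣ x ∣ ≤ M → ∀ k → ∣ x ^ k ∣ ≤ M ^ k
  ^-bound         x≤M zero    = ≤-refl
  ^-bound {x} x≤M (suc k) = subst (_≤ M * M ^ k) (sym (∣p*q∣≡∣p∣*∣q∣ x (x ^ k)))
    (*-mono-≤-nonNeg 0≤M (0≤∣p∣ (x ^ k)) x≤M (^-bound x≤M k))

  module _ {x y} (x≤M : ∣ x ∣ ≤ M) (y≤M : ∣ y ∣ ≤ M) where

    private
      d : ℚ
      d = ∣ x - y ∣

    ^-lipschitz : ∀ k → ∣ x ^ k - y ^ k ∣ ≤ lip M k * d
    ^-lipschitz zero    = ≤-reflexive (sym (*-zeroˡ d))
    ^-lipschitz (suc k) = begin
      ∣ x * x ^ k - y * y ^ k ∣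
        ≡⟨ cong ∣_∣ (regroup x y (x ^ k) (y ^ k)) ⟩
      ∣ x * (x ^ k - y ^ k) + (x - y) * y ^ k ∣
        ≤⟨ ∣p+q∣≤∣p∣+∣q∣ (x * (x ^ k - y ^ k)) ((x - y) * y ^ k) ⟩
      ∣ x * (x ^ k - y ^ k) ∣ + ∣ (x - y) * y ^ k ∣
        ≡⟨ cong₂ _+_ (∣p*q∣≡∣p∣*∣q∣ x (x ^ k - y ^ k)) (∣p*q∣≡∣p∣*∣q∣ (x - y) (y ^ k)) ⟩
      ∣ x ∣ * ∣ x ^ k - y ^ k ∣ + d * ∣ y ^ k ∣
        ≤⟨ +-mono-≤ (*-mono-≤-nonNeg 0≤M (0≤∣p∣ (x ^ k - y ^ k)) x≤M (^-lipschitz k))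
                    (*-monoˡ (0≤∣p∣ (x - y)) (^-bound y≤M k)) ⟩
      M * (lip M k * d) + d * M ^ k
        ≡⟨ collect M (lip M k) d (M ^ k) ⟩
      (M * lip M k + M ^ k) * d ∎
      where
      open ≤-Reasoning
      regroup : ∀ x y a b → x * a - y * b ≡ x * (a - b) + (x - y) * b
      regroup = solve 4 (λ x y a b → x :* a :- y :* b := x :* (a :- b) :+ (x :- y) :* b) refl
        where open +-*-Solver
      collect : ∀ m l d w → m * (l * d) + d * w ≡ (m * l + w) * d
      collect = solve 4 (λ m l d w → m :* (l :* d) :+ d :* w := (m :* l :+ w) :* d) refl
        where open +-*-Solver

    ∑ₗ-lipschitz : ∀ {f g l : A → ℚ} → (∀ a → ∣ f a - g a ∣ ≤ l a * d) →
      ∀ as → ∣ ∑ₗ f as - ∑ₗ g as ∣ ≤ ∑ₗ l as * d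
    ∑ₗ-lipschitz h []       = ≤-reflexive (sym (*-zeroˡ d))
    ∑ₗ-lipschitz {f = f} {g} {l} h (a ∷ as) = begin
      ∣ (f a + ∑ₗ f as) - (g a + ∑ₗ g as) ∣
        ≡⟨ cong ∣_∣ (regroup (f a) (∑ₗ f as) (g a) (∑ₗ g as)) ⟩
      ∣ (f a - g a) + (∑ₗ f as - ∑ₗ g as) ∣
        ≤⟨ ∣p+q∣≤∣p∣+∣q∣ (f a - g a) (∑ₗ f as - ∑ₗ g as) ⟩
      ∣ f a - g a ∣ + ∣ ∑ₗ f as - ∑ₗ g as ∣
        ≤⟨ +-mono-≤ (h a) (∑ₗ-lipschitz h as) ⟩
      l a * d + ∑ₗ l as * d
        ≡⟨ *-distribʳ-+ d (l a) (∑ₗ l as) ⟨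
      (l a + ∑ₗ l as) * d ∎
      where
      open ≤-Reasoning
      regroup : ∀ a b c d → (a + b) - (c + d) ≡ (a - c) + (b - d)
      regroup = solve 4 (λ a b c d → (a :+ b) :- (c :+ d) := (a :- c) :+ (b :- d)) refl
        where open +-*-Solver

    -- The constant sums over all subsets, not just cliques in `A`, so one constant serves every
    -- witness `A` that the bisection meets.
    poly-lipschitz : ∀ {n} (G : Graph n) A →
      ∣ poly G A x - poly G A y ∣ ≤ ∑ₗ (lip M ∘ card) (subsets n) * d
    poly-lipschitz {n} G A = ∑ₗ-lipschitz term (subsets n)
      where
      term : ∀ K → ∣ cliqueTerm G A x K - cliqueTerm G A y K ∣ ≤ lip M (card K) * d
      term K with does (cliqueIn? G A K)
      ... | true  = ^-lipschitz (card K)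
      ... | false = 0≤p*q (0≤lip (card K)) (0≤∣p∣ (x - y))

-- Bisection

-- Identifies the k-fold sum of 1 with the fraction k/1, so that bounds by it become integer
-- inequalities.
toℚᵘ-·1 : ∀ k → toℚᵘ (k · 1ℚ) ℚᵘ.≃ mkℚᵘ (ℤ.+ k) 0
toℚᵘ-·1 zero    = ℚᵘ.≃-refl
toℚᵘ-·1 (suc k) = ℚᵘ.≃-trans (toℚᵘ-homo-+ 1ℚ (k · 1ℚ))
  (ℚᵘ.≃-trans (ℚᵘ.+-congʳ (toℚᵘ 1ℚ) (toℚᵘ-·1 k))
    (ℚᵘ.*≡* (cong (λ i → (ℤ.+ 1 ℤ.+ i) ℤ.* ℤ.+ 1) (ℤ.*-identityʳ (ℤ.+ k)))))

0≤k·1 : ∀ k → 0ℚ ≤ k · 1ℚ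
0≤k·1 zero    = ≤-refl
0≤k·1 (suc k) = 0≤p+q (<⇒≤ (positive⁻¹ 1ℚ)) (0≤k·1 k)

-- The absolute value of the numerator is a bound, since the denominator is at least 1.
unbounded : ∀ p → ∃[ k ] p ≤ k · 1ℚ
unbounded p@(mkℚ i d _) = ℤ.∣ i ∣ , toℚᵘ-cancel-≤
  (ℚᵘ.≤-respʳ-≃ (ℚᵘ.≃-sym (toℚᵘ-·1 ℤ.∣ i ∣)) (ℚᵘ.*≤* (cross i)))
  where
  cross : ∀ i → i ℤ.* ℤ.+ 1 ℤ.≤ ℤ.+ ℤ.∣ i ∣ ℤ.* ℤ.+ suc d
  cross (ℤ.+ a)    = ℤ.*-monoˡ-≤-nonNeg (ℤ.+ a) (ℤ.+≤+ (s≤s z≤n))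
  cross ℤ.-[1+ a ] = ℤ.-≤+

archimedean : ∀ w {ε} → 0ℚ < ε → ∃[ k ] w ≤ (k · 1ℚ) * ε
archimedean w {ε} 0<ε =
  let k , w/ε≤k = unbounded (w * 1/ ε) in
  k , subst (_≤ (k · 1ℚ) * ε) cancel (*-monoʳ (<⇒≤ 0<ε) w/ε≤k)
  where
  instance
    ε≢0 : NonZero ε
    ε≢0 = pos⇒nonZero ε {{positive 0<ε}}
  cancel : (w * 1/ ε) * ε ≡ w
  cancel = trans (*-assoc w (1/ ε) ε) (trans (cong (w *_) (*-inverseˡ ε)) (*-identityʳ w))

abstract
  -- Kept abstract so that the midpoint formula does not unfold in iterated brackets.
  midpoint : ∀ {a b} → a ≤ b →
    ∃[ m ] (a ≤ m × m ≤ b × (m - a) + (m - a) ≡ b - a × (b - m) + (b - m) ≡ b - a)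
  midpoint {a} {b} a≤b = ½ * (a + b)
    , ≤-gap 0≤half (solve 2 (λ a b → a :+ con ½ :* (b :- a) := con ½ :* (a :+ b)) refl a b)
    , ≤-gap 0≤half (solve 2 (λ a b → con ½ :* (a :+ b) :+ con ½ :* (b :- a) := b) refl a b)
    , solve 2 (λ a b → let m = con ½ :* (a :+ b) in (m :- a) :+ (m :- a) := b :- a) refl a b
    , solve 2 (λ a b → let m = con ½ :* (a :+ b) in (b :- m) :+ (b :- m) := b :- a) refl a b
    where
    open +-*-Solver
    0≤half : 0ℚ ≤ ½ * (b - a)
    0≤half = 0≤p*q (<⇒≤ (positive⁻¹ ½)) (p≤q⇒0≤q-p a≤b)

-- The invariant of the bisection: the two ends enclose a change from `P` to its negation.
record Bracket (P : Pred ℚ 0ℓ) : Set where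
  field
    lo hi : ℚ
    lo≤hi : lo ≤ hi
    P-lo  : P lo
    ¬P-hi : ¬ P hi

  width : ℚ
  width = hi - lo

open Bracket

module Bisection {P : Pred ℚ 0ℓ} (P? : Decidable P) (I₀ : Bracket P) where

  _⊑_ : Bracket P → Bracket P → Set
  J ⊑ I = lo I ≤ lo J × hi J ≤ hi I

  halve : ∀ I → ∃[ J ] (J ⊑ I × width J + width J ≡ width I)
  halve I =
    let mid , lo≤mid , mid≤hi , lower , upper = midpoint (lo≤hi I) in
    half mid lo≤mid mid≤hi lower upper (P? mid)
    where
    half : ∀ mid → lo I ≤ mid → mid ≤ hi I →
      (mid - lo I) + (mid - lo I) ≡ width I → (hi I - mid) + (hi I - mid) ≡ width I →
      Dec (P mid) → ∃[ J ] (J ⊑ I × width J + width J ≡ width I)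
    half mid lo≤mid mid≤hi _ upper (yes P-mid) =
      record { lo = mid ; hi = hi I ; lo≤hi = mid≤hi ; P-lo = P-mid ; ¬P-hi = ¬P-hi I }
      , (lo≤mid , ≤-refl) , upper
    half mid lo≤mid mid≤hi lower _ (no ¬P-mid) =
      record { lo = lo I ; hi = mid ; lo≤hi = lo≤mid ; P-lo = P-lo I ; ¬P-hi = ¬P-mid }
      , (≤-refl , mid≤hi) , lower

  bracket : ℕ → Bracket P
  bracket zero    = I₀
  bracket (suc k) = proj₁ (halve (bracket k))

  nested : ∀ {k m} → k ℕ.≤ m → bracket m ⊑ bracket k
  nested k≤m = go (ℕ.≤⇒≤′ k≤m)
    where
    go : ∀ {k m} → k ℕ.≤′ m → bracket m ⊑ bracket k
    go (ℕ.≤′-reflexive refl) = ≤-refl , ≤-refl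
    go {m = suc m} (ℕ.≤′-step k≤m) =
      let lo≤ , hi≤   = go k≤m
          lo≤′ , hi≤′ = proj₁ (proj₂ (halve (bracket m)))
      in ≤-trans lo≤ lo≤′ , ≤-trans hi≤′ hi≤

  -- (k + 1) wₖ ≤ w₀ is weaker than 2ᵏ wₖ ≡ w₀ but suffices.
  width-decay : ∀ k → (suc k · 1ℚ) * width (bracket k) ≤ width I₀
  width-decay zero    = ≤-reflexive (*-identityˡ (width I₀))
  width-decay (suc k) = begin
    (1ℚ + c) * w′
      -- The gap is k w′, since 2(k + 1) - (k + 2) = k.
      ≤⟨ ≤-gap (0≤p*q (0≤k·1 k) (p≤q⇒0≤q-p (lo≤hi (bracket (suc k))))) (double (k · 1ℚ) w′) ⟩
    c * (w′ + w′)
      ≡⟨ cong (c *_) (proj₂ (proj₂ (halve (bracket k)))) ⟩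
    c * width (bracket k)
      ≤⟨ width-decay k ⟩
    width I₀ ∎
    where
    open ≤-Reasoning
    c w′ : ℚ
    c  = suc k · 1ℚ
    w′ = width (bracket (suc k))
    double : ∀ a w → (1ℚ + (1ℚ + a)) * w + a * w ≡ (1ℚ + a) * (w + w)
    double = solve 2 (λ a w → (con 1ℚ :+ (con 1ℚ :+ a)) :* w :+ a :* w := (con 1ℚ :+ a) :* (w :+ w)) refl
      where open +-*-Solver

  width-antitone : ∀ {k m} → k ℕ.≤ m → width (bracket m) ≤ width (bracket k)
  width-antitone k≤m = let lo≤ , hi≤ = nested k≤m in +-mono-≤ hi≤ (neg-antimono-≤ lo≤)

  width-small : ∀ {c ε} → 0ℚ ≤ c → 0ℚ < ε →
    ∃[ k ] (∀ m → k ℕ.≤ m → c * width (bracket m) < ε)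
  width-small {c} {ε} 0≤c 0<ε =
    let k , cW≤kε = archimedean (c * width I₀) 0<ε
        N         = suc k · 1ℚ
        w         = width (bracket k)
        instance
          N-nonNeg = nonNegative (0≤k·1 (suc k))
          ε-pos    = positive 0<ε
    in k , λ m k≤m → ≤-<-trans (*-monoˡ 0≤c (width-antitone k≤m))
      (*-cancelˡ-<-nonNeg N (begin-strict
        N * (c * w)      ≡⟨ exchange N c w ⟩
        c * (N * w)      ≤⟨ *-monoˡ 0≤c (width-decay k) ⟩
        c * width I₀     ≤⟨ cW≤kε ⟩
        -- Passing from k to k + 1 supplies the strict inequality, also for k = 0.
        (k · 1ℚ) * ε     <⟨ *-monoˡ-<-pos ε (subst (_< N) (+-identityˡ (k · 1ℚ)) (+-monoˡ-< (k · 1ℚ) (positive⁻¹ 1ℚ))) ⟩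
        N * ε            ∎))
    where
    open ≤-Reasoning
    exchange : ∀ a b c → a * (b * c) ≡ b * (a * c)
    exchange = solve 3 (λ a b c → a :* (b :* c) := b :* (a :* c)) refl
      where open +-*-Solver

  -- From index k on, all right ends lie in the k-th bracket, so any two differ by at most its
  -- width.
  hi-cauchy : IsCauchy (λ k → hi (bracket k))
  hi-cauchy ε 0<ε =
    let k , small = width-small (<⇒≤ (positive⁻¹ 1ℚ)) 0<ε in
    k , λ m m′ k≤m k≤m′ → ≤-<-trans
      (∣p∣≤ (close k≤m k≤m′)
        (subst (_≤ width (bracket k)) (flip-sign (hi (bracket m′)) (hi (bracket m))) (close k≤m′ k≤m)))
      (subst (_< ε) (*-identityˡ _) (small k ℕ.≤-refl))
    where
    close : ∀ {k m m′} → k ℕ.≤ m → k ℕ.≤ m′ → hi (bracket m) - hi (bracket m′) ≤ width (bracket k)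
    close {m′ = m′} k≤m k≤m′ = +-mono-≤ (proj₂ (nested k≤m))
      (neg-antimono-≤ (≤-trans (proj₁ (nested k≤m′)) (lo≤hi (bracket m′))))
    flip-sign : ∀ a b → a - b ≡ - (b - a)
    flip-sign = solve 2 (λ a b → a :- b := :- (b :- a)) refl
      where open +-*-Solver

  -- Packing the limit with its defining equation lets later proofs treat it as a variable.
  hi-limit : ∃[ t ] (∀ k → seq t k ≡ hi (bracket k))
  hi-limit = mkℝ (λ k → hi (bracket k)) hi-cauchy , λ _ → refl

-- From a failure of positivity to a negative root

≈0ℝ⁺ : ∀ x {f : ℕ → ℚ} → (∀ m → seq x m ≡ f m) → (∀ m → 0ℚ ≤ f m) →
  (∀ ε → 0ℚ < ε → ∃[ N ] (∀ m → N ℕ.≤ m → f m < ε)) → x Real.≈ 0ℝ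
≈0ℝ⁺ x {f} x≗f 0≤f f→0 ε 0<ε = let N , small = f→0 ε 0<ε in
  N , λ m N≤m → subst (_< ε) (sym (abs m)) (small m N≤m)
  where
  abs : ∀ m → ∣ seq x m - 0ℚ ∣ ≡ f m
  abs m = trans (cong ∣_∣ (trans (+-identityʳ (seq x m)) (x≗f m))) (0≤p⇒∣p∣≡p (0≤f m))

≈0ℝ⁻ : ∀ x {f : ℕ → ℚ} → (∀ m → seq x m ≡ f m) → x Real.≈ 0ℝ →
  ∀ ε → 0ℚ < ε → ∃[ N ] (∀ m → N ℕ.≤ m → f m < ε)
≈0ℝ⁻ x {f} x≗f x≈0 ε 0<ε = let N , small = x≈0 ε 0<ε in
  N , λ m N≤m → ≤-<-trans (below m) (small m N≤m)
  where
  below : ∀ m → f m ≤ ∣ seq x m - 0ℚ ∣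
  below m = subst₂ _≤_ (x≗f m) (+-identityʳ ∣ seq x m - 0ℚ ∣) (p≤∣p-q∣+q (seq x m) 0ℚ)

module _ {n} (G : Graph n) (B : Subset n) {q} (q≤0 : q ≤ 0ℚ) (bad : Bad G B q) where

  private
    good-0 : ¬ Bad G B 0ℚ
    good-0 (A , _ , p≤0) = <⇒≱ (positive⁻¹ 1ℚ) (subst (_≤ 0ℚ) (poly-at-0 G A) p≤0)

    initial : Bracket (Bad G B)
    initial = record { lo = q ; hi = 0ℚ ; lo≤hi = q≤0 ; P-lo = bad ; ¬P-hi = good-0 }

    open Bisection (bad? G B) initial

    lower upper f : ℕ → ℚ
    lower k = lo (bracket k)
    upper k = hi (bracket k)
    f k = poly G B (upper k)

    q≤lower : ∀ k → q ≤ lower k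
    q≤lower k = proj₁ (nested {0} {k} z≤n)

    upper≤0 : ∀ k → upper k ≤ 0ℚ
    upper≤0 k = proj₂ (nested {0} {k} z≤n)

    q≤upper : ∀ k → q ≤ upper k
    q≤upper k = ≤-trans (q≤lower k) (lo≤hi (bracket k))

    bounded : ∀ {x} → q ≤ x → x ≤ 0ℚ → ∣ x ∣ ≤ - q
    bounded q≤x x≤0 = ∣p∣≤ (≤-trans x≤0 (p≤0⇒0≤-p q≤0)) (neg-antimono-≤ q≤x)

    L : ℚ
    L = ∑ₗ (lip (- q) ∘ card) (subsets n)

    0≤L : 0ℚ ≤ L
    0≤L = ∑ₗ-≥0 (λ K → 0≤lip (p≤0⇒0≤-p q≤0) (card K)) (subsets n)

    0<f : ∀ k → 0ℚ < f k
    0<f k = poly-positive G B (upper≤0 k) (¬P-hi (bracket k)) ⊆-refl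

    -- A witness A of the failure at the left end has polynomial ≤ 0 there, and it
    -- dominates that of B at the right end.
    f≤Lw : ∀ k → f k ≤ L * width (bracket k)
    f≤Lw k with P-lo (bracket k)
    ... | A , A⊆B , p≤0 = begin
      f k
        ≤⟨ poly-antitone G B (upper≤0 k) (¬P-hi (bracket k)) A⊆B ⊆-refl ⟩
      poly G A (upper k)
        ≤⟨ p≤∣p-q∣+q (poly G A (upper k)) (poly G A (lower k)) ⟩
      ∣ poly G A (upper k) - poly G A (lower k) ∣ + poly G A (lower k)
        ≤⟨ +-mono-≤ (poly-lipschitz (p≤0⇒0≤-p q≤0) (bounded (q≤upper k) (upper≤0 k))
             (bounded (q≤lower k) (≤-trans (lo≤hi (bracket k)) (upper≤0 k))) G A) p≤0 ⟩
      L * ∣ width (bracket k) ∣ + 0ℚ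
        ≡⟨ +-identityʳ _ ⟩
      L * ∣ width (bracket k) ∣
        ≡⟨ cong (L *_) (0≤p⇒∣p∣≡p (p≤q⇒0≤q-p (lo≤hi (bracket k)))) ⟩
      L * width (bracket k) ∎
      where open ≤-Reasoning

    -- The polynomial is 1 at 0, so a value below 1 keeps the right end away from 0.
    upper<0 : ∀ {k} → f k < 1ℚ → upper k < 0ℚ
    upper<0 {k} f<1 = ≰⇒> (λ 0≤u → <-irrefl
      (trans (cong (poly G B) (≤-antisym (upper≤0 k) 0≤u)) (poly-at-0 G B)) f<1)

    -- Stated for a variable t, since conversion checking blows up on the limit itself.
    module _ (t : ℝ) (t≗upper : ∀ k → seq t k ≡ upper k) where

      isRoot : cliquePoly G B t Real.≈ 0ℝ
      isRoot = ≈0ℝ⁺ (cliquePoly G B t)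
        (λ m → trans (seq-cliquePoly G B t m) (cong (poly G B) (t≗upper m)))
        (λ k → <⇒≤ (0<f k))
        (λ ε 0<ε → let k , small = width-small 0≤L 0<ε in
          k , λ m k≤m → ≤-<-trans (f≤Lw m) (small m k≤m))

      t<0 : t Real.< 0ℝ
      t<0 =
        let k , small = width-small 0≤L (positive⁻¹ 1ℚ)
            u         = upper k
            ½u<0      = subst (½ * u <_) (*-zeroʳ ½)
                          (*-monoʳ-<-pos ½ (upper<0 {k} (≤-<-trans (f≤Lw k) (small k ℕ.≤-refl))))
        -- Right ends never increase, so later terms are at most `u`, and adding the margin -u/2
        -- leaves at most u/2 < 0.
        in - (½ * u) , neg-antimono-< ½u<0 , k , λ m k≤m →
          ≤-<-trans
            (+-monoˡ-≤ (- (½ * u)) (subst (_≤ u) (sym (t≗upper m)) (proj₂ (nested k≤m))))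
            (subst (_< 0ℚ) (sym (halved u)) ½u<0)
        where
        halved : ∀ u → u - ½ * u ≡ ½ * u
        halved = solve 1 (λ u → u :- con ½ :* u := con ½ :* u) refl
          where open +-*-Solver

      q≤t : ∀ k → q ≤ seq t k
      q≤t k = subst (q ≤_) (sym (t≗upper k)) (q≤upper k)

  bad⇒root : ∃[ t ] (NegativeRoot G B t × (∀ k → q ≤ seq t k))
  bad⇒root = case hi-limit of λ (t , t≗upper) →
    t , (t<0 t t≗upper , isRoot t t≗upper) , q≤t t t≗upper

-- Comparison of the roots

module _ {n} (G H : Graph n) (H⊆G : SpanningSubgraph H G) (B : Subset n)
         r (r-negRoot : NegativeRoot G B r)
         {q} (q≤r : ∃[ N ] (∀ m → N ℕ.≤ m → q ≤ seq r m)) where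

  private
    sampleBounds : ∀ K → ∃[ m ] (K ℕ.≤ m × q ≤ seq r m × seq r m ≤ 0ℚ)
    sampleBounds K =
      let N , q≤         = q≤r
          ε , 0<ε , N′ , r+ε<0 = proj₁ r-negRoot
          m              = K ℕ.⊔ (N ℕ.⊔ N′)
          N⊔N′≤m         = ℕ.m≤n⊔m K (N ℕ.⊔ N′)
      in m , ℕ.m≤m⊔n K (N ℕ.⊔ N′)
       , q≤ m (ℕ.≤-trans (ℕ.m≤m⊔n N N′) N⊔N′≤m)
       , <⇒≤ (≤-<-trans (≤-gap (<⇒≤ 0<ε) refl) (r+ε<0 m (ℕ.≤-trans (ℕ.m≤n⊔m N N′) N⊔N′≤m)))

    q≤0 : q ≤ 0ℚ
    q≤0 = let _ , _ , q≤rₘ , rₘ≤0 = sampleBounds 0 in ≤-trans q≤rₘ rₘ≤0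

    -- Were `H` positive at `q`, the values of `G` along `r` would stay above `poly H B q > 0`
    -- instead of tending to 0. Decidability of `Bad` turns this contradiction into a witness.
    bad : Bad H B q
    bad = decidable-stable (bad? H B q) λ good →
      let δ>0                    = poly-positive H B q≤0 good ⊆-refl
          K , small              = ≈0ℝ⁻ (cliquePoly G B r) (seq-cliquePoly G B r) (proj₂ r-negRoot) (poly H B q) δ>0
          m , K≤m , q≤rₘ , rₘ≤0 = sampleBounds K
      in <⇒≱ (small m K≤m) (poly-mono-graph G H H⊆G B q≤rₘ rₘ≤0 good)

  -- A rational `q` below `r` takes the place of `r`, as positivity is decided at rational points.
  -- How close it lies to `r` is left to the application.
  root⇒root : ∃[ t ] (NegativeRoot H B t × (∀ k → q ≤ seq t k))
  root⇒root = bad⇒root H B q≤0 bad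

-- Rational bounds for reals

∣p-q∣<r⇒p<r+q : ∀ p q → ∣ p - q ∣ < r → p < r + q
∣p-q∣<r⇒p<r+q p q h = ≤-<-trans (p≤∣p-q∣+q p q) (+-monoˡ-< q h)

∣p-q∣<r⇒q<r+p : ∀ p q → ∣ p - q ∣ < r → q < r + p
∣p-q∣<r⇒q<r+p {r} p q h = ∣p-q∣<r⇒p<r+q q p (subst (_< r) swap h)
  where
  swap : ∣ p - q ∣ ≡ ∣ q - p ∣
  swap = trans (sym (∣-p∣≡∣p∣ (p - q)))
    (cong ∣_∣ (solve 2 (λ p q → :- (p :- q) := q :- p) refl p q))
    where open +-*-Solver

p<r+q⇒p-r≤q : ∀ r q → p < r + q → p - r ≤ q
p<r+q⇒p-r≤q r q h = ≤-trans (+-monoˡ-≤ (- r) (<⇒≤ h))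
  (≤-reflexive (solve 2 (λ r q → (r :+ q) :- r := q) refl r q))
  where open +-*-Solver

rationalBelow : ∀ x → ∃[ q ] ∃[ N ] (∀ m → N ℕ.≤ m → q ≤ seq x m)
rationalBelow x =
  let N , close = cauchy x 1ℚ (positive⁻¹ 1ℚ) in
  seq x N - 1ℚ , N , λ m N≤m → p<r+q⇒p-r≤q 1ℚ (seq x m) (∣p-q∣<r⇒p<r+q (seq x N) (seq x m) (close N m ℕ.≤-refl N≤m))

-- A constructive substitute for deciding `x ≤ y`. Past `N` both sequences are within δ = ε/5 of `a`
-- and `b`, so one rational comparison settles the case: a < b + 3δ costs 5δ = ε in total, and
-- otherwise a - δ separates, because b + 2δ ≤ a - δ.
≤-or-separated : ∀ x y {ε} → 0ℚ < ε →
  (∃[ N ] (∀ m → N ℕ.≤ m → seq x m < seq y m + ε)) ⊎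
  (∃[ q ] ((∃[ N ] (∀ m → N ℕ.≤ m → q ≤ seq x m)) ×
    ∃[ δ ] (0ℚ < δ × ∃[ N ] (∀ m → N ℕ.≤ m → seq y m + δ < q))))
≤-or-separated x y {ε} 0<ε = case a <? b + (δ + δ + δ) of λ where
    (yes a<b+3δ) → inj₁ (N , λ m N≤m → begin-strict
      seq x m
        <⟨ ∣p-q∣<r⇒p<r+q (seq x m) a (x-close m N (Nˣ≤ N≤m) (Nˣ≤ ℕ.≤-refl)) ⟩
      δ + a
        <⟨ +-monoʳ-< δ a<b+3δ ⟩
      δ + (b + (δ + δ + δ))
        <⟨ +-monoʳ-< δ (+-monoˡ-< (δ + δ + δ) (∣p-q∣<r⇒q<r+p (seq y m) b (y-close m N (Nʸ≤ N≤m) (Nʸ≤ ℕ.≤-refl)))) ⟩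
      δ + ((δ + seq y m) + (δ + δ + δ))
        ≡⟨ five (seq y m) ε ⟩
      seq y m + ε ∎)
    (no a≮b+3δ) → inj₂ (a - δ
      , (N , λ m N≤m → p<r+q⇒p-r≤q δ (seq x m) (∣p-q∣<r⇒q<r+p (seq x m) a (x-close m N (Nˣ≤ N≤m) (Nˣ≤ ℕ.≤-refl))))
      , δ , 0<δ , N , λ m N≤m → begin-strict
      seq y m + δ
        <⟨ +-monoˡ-< δ (∣p-q∣<r⇒p<r+q (seq y m) b (y-close m N (Nʸ≤ N≤m) (Nʸ≤ ℕ.≤-refl))) ⟩
      (δ + b) + δ
        ≡⟨ solve 2 (λ b d → (d :+ b) :+ d := (b :+ (d :+ d :+ d)) :- d) refl b δ ⟩
      (b + (δ + δ + δ)) - δ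
        ≤⟨ +-monoˡ-≤ (- δ) (≮⇒≥ a≮b+3δ) ⟩
      a - δ ∎)
  where
  open ≤-Reasoning
  open +-*-Solver
  ⅕ δ : ℚ
  ⅕ = ℤ.+ 1 ÷ 5
  δ = ⅕ * ε
  0<δ : 0ℚ < δ
  0<δ = subst (_< δ) (*-zeroʳ ⅕) (*-monoʳ-<-pos ⅕ 0<ε)
  five : ∀ c ε → ⅕ * ε + ((⅕ * ε + c) + (⅕ * ε + ⅕ * ε + ⅕ * ε)) ≡ c + ε
  five = solve 2 (λ c e → let d = con ⅕ :* e in
    d :+ ((d :+ c) :+ (d :+ d :+ d)) := c :+ e) refl
  Nˣ Nʸ N : ℕ
  Nˣ = proj₁ (cauchy x δ 0<δ)
  Nʸ = proj₁ (cauchy y δ 0<δ)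
  N  = Nˣ ℕ.⊔ Nʸ
  x-close = proj₂ (cauchy x δ 0<δ)
  y-close = proj₂ (cauchy y δ 0<δ)
  Nˣ≤ : ∀ {m} → N ℕ.≤ m → Nˣ ℕ.≤ m
  Nˣ≤ = ℕ.m⊔n≤o⇒m≤o Nˣ Nʸ
  Nʸ≤ : ∀ {m} → N ℕ.≤ m → Nʸ ℕ.≤ m
  Nʸ≤ = ℕ.m⊔n≤o⇒n≤o Nˣ Nʸ
  a b : ℚ
  a = seq x N
  b = seq y N

theorem2p6 : ∀ (n : ℕ) (G H : Graph n) → SpanningSubgraph H G →
    ∀ (B : Subset n) (ζG ζH : ℝ ₋) → IsZeta G B ζG → IsZeta H B ζH → ζG ≤₋ ζH
theorem2p6 n G H H⊆G B _ _ (noRoot _) _ = ⊥₋≤ _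
theorem2p6 n G H H⊆G B _ _ (maxRoot {r} r-root _) (noRoot none) =
  -- Any rational below `r` serves here, since every negative root of `H` contradicts `none`.
  case root⇒root G H H⊆G B r r-root (proj₂ (rationalBelow r)) of λ (t , t-root , _) →
    ⊥-elim (none t t-root)
theorem2p6 n G H H⊆G B _ _ (maxRoot {r} r-root _) (maxRoot {s} _ s-max) = [ r≤s ]
  where
  r≤s : r Real.≤ s
  -- In the separated case a rational `q` lies above `s` and not above `r`; the root of `H` that it
  -- yields is at least `q`, against the maximality of `s`.
  r≤s ε 0<ε = case ≤-or-separated r s 0<ε of λ where
    (inj₁ below) → below
    (inj₂ (q , q≤r , δ , 0<δ , N , s+δ<q)) →
      case root⇒root G H H⊆G B r r-root q≤r of λ (t , t-root , q≤t) →
        let N′ , t<s+δ = s-max t t-root δ 0<δ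
            m          = N ℕ.⊔ N′
        in contradiction
          (≤-<-trans (q≤t m) (<-trans (t<s+δ m (ℕ.m≤n⊔m N N′)) (s+δ<q m (ℕ.m≤m⊔n N N′))))
          (<-irrefl refl)
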